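{- Let $n\ge 0$ be an integer. Then $$\sum_{k=0}^{2n+1}\binom{2n+1}{k}\Bigl(\prod_{j=1}^{2n+1}(6n-2k+4-2j)\Bigr)(-1)^k\,3^{2k+1}+\sum_{k=0}^{2n+1}\binom{2n+1}{k}\Bigl(\prod_{j=1}^{2n+1}(6n-2k+5-2j)\Bigr)(-1)^k\,3^{2k}=0.$$
   Context: The identity is between integers; the factors in the products may be negative or zero. -}

module Defs where

open import Data.Nat.Base using (ℕ; suc)
open import Data.Integer.Base using (ℤ)
open import Data.Integer.Properties using (+-0-monoid; *-1-monoid)
open import Data.Fin.Base using (toℕ)
import Algebra.Properties.Monoid.Sum as Sum

-- f 0 + f 1 + … + f m: both endpoints are included.
sumTo : ℕ → (ℕ → ℤ) → ℤ
sumTo m f = Sum.sum +-0-monoid {suc m} (λ i → f (toℕ i))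

-- f 1 * f 2 * … * f m: the library's monoid "sum", taken in (ℤ, *, 1).
-- Fin m counts from 0, hence the suc.
productTo : ℕ → (ℕ → ℤ) → ℤ
productTo m f = Sum.sum *-1-monoid {m} (λ i → f (suc (toℕ i)))

syntax sumTo m (λ k → e) = ∑[0≤ k ≤ m ] e
syntax productTo m (λ j → e) = ∏[1≤ j ≤ m ] e

{-# OPTIONS --safe #-}
module Submission where

-- Write f(x) = (x − 2)(x − 4)⋯(x − 2N), N = 2n + 1, and extend y^m ↦ f(m + 1) to a
-- linear functional on ℤ[y]. Up to a constant it is P ↦ Res_{y=1} P dy / (y² − 1)^{N+1},
-- and by the binomial theorem the two sums together are its value at
-- y^N (y² − 9)^N (y + 3). The coordinate z = (y − 1)/(y + 3) turns the corresponding
-- differential form into a constant times (9z² − 1)^N dz / (z (1 − z²))^{N+1}, which is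
-- even in z because N is odd, so its residue at z = 0 vanishes. In terms of polynomials:
-- 8y(y − 3) = 9(y − 1)² − (y + 3)², so the argument of the functional is, up to 8^N, a
-- combination of (y − 1)^{2s} (y + 3)^{2t} with s + t = 3n + 2, and each of these is
-- killed, by repeated use of (y + 3)² = 8(y + 1) + (y − 1)².

open import Defs
open import Data.Nat.Base as ℕ using (ℕ; zero; suc)
import Data.Nat.Properties as ℕ
open import Data.Nat.Combinatorics using (_C_)
open import Data.Integer.Base using (ℤ; +_; _+_; _-_; -_; _*_; _^_; 0ℤ; 1ℤ; -1ℤ)
import Data.Integer.Properties as ℤ
open import Data.Integer.Tactic.RingSolver using (solve-∀)
open import Data.Fin.Base using (Fin; toℕ)
open import Data.Fin.Properties using (toℕ≤pred[n])
open import Data.Sum.Base using ([_,_]′)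
open import Data.Product.Base using (_,_)
open import Function.Base using (_∘_; id)
open import Algebra.Bundles using (CommutativeSemiring)
open import Algebra.Structures.Biased using (isCommutativeSemiringˡ)
open import Level using (0ℓ)
open import Relation.Nullary.Decidable using (yes; no)
open import Relation.Nullary.Negation using (contradiction)
open import Relation.Binary.Structures using (IsEquivalence)
open import Relation.Binary.PropositionalEquality

-- Polynomials as operators on functions.

infixl 6 _⊕_
infixl 7 _⊗_

data Poly : Set where
  X       : Poly
  con     : ℤ → Poly
  _⊕_ _⊗_ : Poly → Poly → Poly

-- The variable acts as the shift operator, so that evaluation of act P f at x is the
-- linear functional y^m ↦ f(x + m).
act : Poly → (ℤ → ℤ) → ℤ → ℤ
act X       f x = f (x + 1ℤ)
act (con c) f x = c * f x
act (P ⊕ Q) f x = act P f x + act Q f x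
act (P ⊗ Q) f x = act P (act Q f) x

act-cong : ∀ P {f g} → f ≗ g → act P f ≗ act P g
act-cong X       e x = e _
act-cong (con c) e x = cong (c *_) (e x)
act-cong (P ⊕ Q) e x = cong₂ _+_ (act-cong P e x) (act-cong Q e x)
act-cong (P ⊗ Q) e x = act-cong P (act-cong Q e) x

act-+ : ∀ P f g → act P (λ y → f y + g y) ≗ λ x → act P f x + act P g x
act-+ X       f g x = refl
act-+ (con c) f g x = ℤ.*-distribˡ-+ c (f x) (g x)
act-+ (P ⊕ Q) f g x = trans (cong₂ _+_ (act-+ P f g x) (act-+ Q f g x))
                               (lem (act P f x) (act P g x) (act Q f x) (act Q g x))
  where
  lem : ∀ a b c d → a + b + (c + d) ≡ a + c + (b + d)
  lem = solve-∀
act-+ (P ⊗ Q) f g x = trans (act-cong P (act-+ Q f g) x) (act-+ P _ _ x)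

act-* : ∀ P c f → act P (λ y → c * f y) ≗ λ x → c * act P f x
act-* X       c f x = refl
act-* (con d) c f x = swap d c (f x)
  where
  swap : ∀ a b d → a * (b * d) ≡ b * (a * d)
  swap = solve-∀
act-* (P ⊕ Q) c f x =
  trans (cong₂ _+_ (act-* P c f x) (act-* Q c f x)) (sym (ℤ.*-distribˡ-+ c _ _))
act-* (P ⊗ Q) c f x = trans (act-cong P (act-* Q c f) x) (act-* P c _ x)

act-shift : ∀ P f → act P (λ y → f (y + 1ℤ)) ≗ λ x → act P f (x + 1ℤ)
act-shift X       f x = refl
act-shift (con c) f x = refl
act-shift (P ⊕ Q) f x = cong₂ _+_ (act-shift P f x) (act-shift Q f x)
act-shift (P ⊗ Q) f x = trans (act-cong P (act-shift Q f) x) (act-shift P _ x)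

act-comm : ∀ P Q f → act P (act Q f) ≗ act Q (act P f)
act-comm X       Q f x = sym (act-shift Q f x)
act-comm (con c) Q f x = sym (act-* Q c f x)
act-comm (P ⊕ R) Q f x = trans (cong₂ _+_ (act-comm P Q f x) (act-comm R Q f x))
                               (sym (act-+ Q _ _ x))
act-comm (P ⊗ R) Q f x = trans (act-cong P (act-comm R Q f) x) (act-comm P Q _ x)

act-zero : ∀ P {f} → (∀ x → f x ≡ 0ℤ) → ∀ x → act P f x ≡ 0ℤ
act-zero P e x = trans (act-cong P e x) (act-* P 0ℤ (λ _ → 0ℤ) x)

-- The commutative semiring of polynomials.

infix 4 _≈_
-- Equality as operators turns a concrete identity into a ring identity in the values f(x), f(x +
-- 1), f(x + 2). The record wrapper lets P and Q be inferred.
record _≈_ (P Q : Poly) : Set where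
  constructor same
  field at : ∀ f → act P f ≗ act Q f
open _≈_

polySemiring : CommutativeSemiring 0ℓ 0ℓ
polySemiring = record
  { Carrier = Poly ; _≈_ = _≈_ ; _+_ = _⊕_ ; _*_ = _⊗_ ; 0# = con 0ℤ ; 1# = con 1ℤ
  ; isCommutativeSemiring = isCommutativeSemiringˡ record
    { +-isCommutativeMonoid = record
      { isMonoid = record
        { isSemigroup = record
          { isMagma = record
            { isEquivalence = ≈-equiv
            ; ∙-cong = λ p q → same λ f x → cong₂ _+_ (at p f x) (at q f x) }
          ; assoc = λ P Q R → same λ f x → ℤ.+-assoc (act P f x) _ _ }
        ; identity = (λ P → same λ f x → ℤ.+-identityˡ _)
                   , (λ P → same λ f x → ℤ.+-identityʳ _) }
      ; comm = λ P Q → same λ f x → ℤ.+-comm (act P f x) _ }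
    ; *-isCommutativeMonoid = record
      { isMonoid = record
        { isSemigroup = record
          { isMagma = record
            { isEquivalence = ≈-equiv
            ; ∙-cong = λ {P} p q → same λ f x →
                trans (act-cong P (at q f) x) (at p _ x) }
          ; assoc = λ P Q R → same λ f x → refl }
        ; identity = (λ P → same λ f x → ℤ.*-identityˡ _)
                   , (λ P → same λ f x → act-cong P (λ y → ℤ.*-identityˡ _) x) }
      ; comm = λ P Q → same (act-comm P Q) }
    ; distribʳ = λ P Q R → same λ f x → refl
    ; zeroˡ = λ P → same λ f x → refl }
  }
  where
  ≈-equiv : IsEquivalence _≈_
  ≈-equiv = record
    { refl  = same λ f x → refl
    ; sym   = λ p → same λ f x → sym (at p f x)
    ; trans = λ p q → same λ f x → trans (at p f x) (at q f x) }

import Algebra.Properties.Monoid.Sum ℤ.*-1-monoid as ProductProperties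

module P = CommutativeSemiring polySemiring
open import Algebra.Properties.CommutativeSemiring.Exp polySemiring
  using (^-congˡ; ^-congʳ; ^-homo-*; ^-assocʳ; ^-distrib-*)
  renaming (_^_ to _⋆_)
open import Algebra.Properties.CommutativeSemigroup P.*-commutativeSemigroup
  using (x∙yz≈y∙xz; interchange)
import Algebra.Properties.Monoid.Sum P.+-monoid as PolySum
import Algebra.Properties.Semiring.Mult P.semiring as PolyMult
open import Algebra.Properties.CommutativeMonoid.Sum ℤ.+-0-commutativeMonoid
  using (sum; sum-cong-≗; ∑-distrib-+)
import Algebra.Properties.CommutativeSemiring.Binomial polySemiring as Binomial
import Relation.Binary.Reasoning.Setoid P.setoid as ≈-Reasoning

-- Commutation with multiplication by x + c.

-- The derivation y d/dy.
D : Poly → Poly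
D X       = X
D (con c) = con 0ℤ
D (P ⊕ Q) = D P ⊕ D Q
D (P ⊗ Q) = D P ⊗ Q ⊕ P ⊗ D Q

-- The commutator of the shift with multiplication by x + c is the shift itself, which is `D X`;
-- scalars commute. Commutators obey the product rule, as `D` does.
leibniz : ∀ P c g x →
  act P (λ y → (y + c) * g y) x ≡ (x + c) * act P g x + act (D P) g x
leibniz X c g x = lem x c (g (x + 1ℤ))
  where
  lem : ∀ x c u → (x + 1ℤ + c) * u ≡ (x + c) * u + u
  lem = solve-∀
leibniz (con a) c g x = lem a x c (g x)
  where
  lem : ∀ a x c u → a * ((x + c) * u) ≡ (x + c) * (a * u) + 0ℤ * u
  lem = solve-∀
leibniz (P ⊕ Q) c g x =
  trans (cong₂ _+_ (leibniz P c g x) (leibniz Q c g x)) (lem (x + c) _ _ _ _)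
  where
  lem : ∀ k a b a′ b′ → k * a + b + (k * a′ + b′) ≡ k * (a + a′) + (b + b′)
  lem = solve-∀
leibniz (P ⊗ Q) c g x = begin
  act P (act Q (λ y → (y + c) * g y)) x
    ≡⟨ act-cong P (leibniz Q c g) x ⟩
  act P (λ y → (y + c) * act Q g y + act (D Q) g y) x
    ≡⟨ act-+ P _ _ x ⟩
  act P (λ y → (y + c) * act Q g y) x + act P (act (D Q) g) x
    ≡⟨ cong (_+ _) (leibniz P c _ x) ⟩
  (x + c) * act P (act Q g) x + act (D P) (act Q g) x + act P (act (D Q) g) x
    ≡⟨ ℤ.+-assoc ((x + c) * _) _ _ ⟩
  (x + c) * act P (act Q g) x + (act (D P) (act Q g) x + act P (act (D Q) g) x) ∎
  where open ≡-Reasoning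

D-⋆ : ∀ P k → D (P ⋆ suc k) ≈ con (+ suc k) ⊗ (D P ⊗ P ⋆ k)
D-⋆ P zero = same λ f x → begin
  act (D P) (λ y → 1ℤ * f y) x + act P (λ y → 0ℤ * f y) x
    ≡⟨ cong (λ z → act (D P) (λ y → 1ℤ * f y) x + z) (act-zero P (λ _ → refl) x) ⟩
  act (D P) (λ y → 1ℤ * f y) x + 0ℤ
    ≡⟨ lem _ ⟩
  1ℤ * act (D P) (λ y → 1ℤ * f y) x ∎
  where
  open ≡-Reasoning
  lem : ∀ u → u + 0ℤ ≡ 1ℤ * u
  lem = solve-∀
D-⋆ P (suc k) = begin
  D P ⊗ P ⋆ suc k ⊕ P ⊗ D (P ⋆ suc k)
    ≈⟨ P.+-congˡ (P.*-congˡ (D-⋆ P k)) ⟩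
  D P ⊗ P ⋆ suc k ⊕ P ⊗ (con (+ suc k) ⊗ (D P ⊗ P ⋆ k))
    ≈⟨ P.+-congˡ (P.trans (x∙yz≈y∙xz P _ _) (P.*-congˡ (x∙yz≈y∙xz P _ _))) ⟩
  D P ⊗ P ⋆ suc k ⊕ con (+ suc k) ⊗ (D P ⊗ P ⋆ suc k)
    ≈⟨ same (λ f x → sym (ℤ.suc-* (+ suc k) _)) ⟩
  con (+ suc (suc k)) ⊗ (D P ⊗ P ⋆ suc k) ∎
  where open ≈-Reasoning

-- Products with step 2.

fall : ℕ → ℤ → ℤ
fall N x = ∏[1≤ j ≤ N ] (x - + 2 * + j)

fall-head : ∀ N x → fall (suc N) (x + + 2) ≡ x * fall N x
fall-head N x = cong₂ _*_ (e₁ x) (ProductProperties.sum-cong-≗ {N} λ i → e₂ x (+ suc (toℕ i)))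
  where
  e₁ : ∀ x → x + + 2 - + 2 * + 1 ≡ x
  e₁ = solve-∀
  e₂ : ∀ x j → x + + 2 - + 2 * (1ℤ + j) ≡ x - + 2 * j
  e₂ = solve-∀

-- The product unfolds at its first factor, so the last is reached by induction: `fall-head` strips
-- the first factor and then restores it.
fall-last : ∀ N x → fall (suc N) x ≡ (x - + 2 * + suc N) * fall N x
fall-last zero    x = refl
fall-last (suc N) x = begin
  fall (suc (suc N)) x
    ≡⟨ cong (fall (suc (suc N))) (e₁ x) ⟨
  fall (suc (suc N)) (y + + 2)
    ≡⟨ fall-head (suc N) y ⟩
  y * fall (suc N) y
    ≡⟨ cong (y *_) (fall-last N y) ⟩
  y * ((y - + 2 * + suc N) * fall N y)
    ≡⟨ e₂ x (+ suc N) (fall N y) ⟩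
  (x - + 2 * (1ℤ + + suc N)) * (y * fall N y)
    ≡⟨ cong ((x - + 2 * + suc (suc N)) *_) (fall-head N y) ⟨
  (x - + 2 * + suc (suc N)) * fall (suc N) (y + + 2)
    ≡⟨ cong (λ z → (x - + 2 * + suc (suc N)) * fall (suc N) z) (e₁ x) ⟩
  (x - + 2 * + suc (suc N)) * fall (suc N) x ∎
  where
  open ≡-Reasoning
  y = x - + 2
  e₁ : ∀ x → x - + 2 + + 2 ≡ x
  e₁ = solve-∀
  e₂ : ∀ x m u → (x - + 2) * ((x - + 2 - + 2 * m) * u) ≡ (x - + 2 * (1ℤ + m)) * ((x - + 2) * u)
  e₂ = solve-∀

X-1 X+1 X+3 : Poly
X-1 = X ⊕ con -1ℤ
X+1 = X ⊕ con 1ℤ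
X+3 = X ⊕ con (+ 3)

-- y² - 1 acts as f(x + 2) - f(x), and both values are linear multiples of `fall N x`.
X²-1-fall : ∀ N x → act (X-1 ⊗ X+1) (fall (suc N)) x ≡ + 2 * + suc N * fall N x
X²-1-fall N x = begin
  act (X-1 ⊗ X+1) f x
    ≡⟨ e₁ (f (x + 1ℤ + 1ℤ)) (f (x + 1ℤ)) (f x) ⟩
  f (x + 1ℤ + 1ℤ) - f x
    ≡⟨ cong₂ _-_ (trans (cong f (ℤ.+-assoc x 1ℤ 1ℤ)) (fall-head N x)) (fall-last N x) ⟩
  x * fall N x - (x - + 2 * + suc N) * fall N x
    ≡⟨ e₂ x (+ 2 * + suc N) (fall N x) ⟩
  + 2 * + suc N * fall N x ∎
  where
  open ≡-Reasoning
  f = fall (suc N)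
  e₁ : ∀ a b c → a + 1ℤ * b + -1ℤ * (b + 1ℤ * c) ≡ a - c
  e₁ = solve-∀
  e₂ : ∀ x m u → x * u - (x - m) * u ≡ m * u
  e₂ = solve-∀

-- The residue functional.

-- 2^{N+1} N! times the residue of P dy / (y² − 1)^{N+1} at y = 1.
res : ℕ → Poly → ℤ
res N P = act P (fall N) 1ℤ

res-cong : ∀ N {P Q} → P ≈ Q → res N P ≡ res N Q
res-cong N e = at e (fall N) 1ℤ

-- The factor y² - 1 cancels one in the denominator; 2(N + 1) is the ratio of the normalising
-- constants for N + 1 and N.
res-X²-1 : ∀ N P → res (suc N) (P ⊗ (X-1 ⊗ X+1)) ≡ + 2 * + suc N * res N P
res-X²-1 N P = trans (act-cong P (X²-1-fall N) 1ℤ) (act-* P (+ 2 * + suc N) (fall N) 1ℤ)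

-- y - 1 is the forward difference, and `fall N` has degree N. Splitting off the last linear factor,
-- Leibniz leaves (y - 1)^{N+1} acting on `fall N` in both terms.
X-1-annihilates-fall : ∀ N x → act (X-1 ⋆ suc N) (fall N) x ≡ 0ℤ
X-1-annihilates-fall zero x = refl
X-1-annihilates-fall (suc N) x = begin
  act (X-1 ⋆ suc (suc N)) (fall (suc N)) x
    ≡⟨ act-cong (X-1 ⋆ suc (suc N)) (fall-last N) x ⟩
  act (X-1 ⋆ suc (suc N)) (λ y → (y - + 2 * + suc N) * fall N y) x
    ≡⟨ leibniz (X-1 ⋆ suc (suc N)) _ (fall N) x ⟩
  (x - + 2 * + suc N) * act X-1 (act (X-1 ⋆ suc N) (fall N)) x + act (D (X-1 ⋆ suc (suc N))) (fall N) x
    ≡⟨ cong₂ _+_ (cong ((x - + 2 * + suc N) *_) (act-zero X-1 (X-1-annihilates-fall N) x))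
                 (at (D-⋆ X-1 (suc N)) (fall N) x) ⟩
  (x - + 2 * + suc N) * 0ℤ + + suc (suc N) * act (D X-1) (act (X-1 ⋆ suc N) (fall N)) x
    ≡⟨ cong₂ (λ u v → u + + suc (suc N) * v) (ℤ.*-zeroʳ (x - + 2 * + suc N))
             (act-zero (D X-1) (X-1-annihilates-fall N) x) ⟩
  0ℤ + + suc (suc N) * 0ℤ
    ≡⟨ cong (λ v → 0ℤ + v) (ℤ.*-zeroʳ (+ suc (suc N))) ⟩
  0ℤ ∎
  where open ≡-Reasoning

res-X-1-high : ∀ N P → res N (X-1 ⋆ suc N ⊗ P) ≡ 0ℤ
res-X-1-high N P = trans (res-cong N (P.*-comm (X-1 ⋆ suc N) P))
                       (act-zero P (X-1-annihilates-fall N) 1ℤ)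

-- Exactness: (y + 1)^{k+2} dy / (y² − 1)^{k+2} is the differential of a rational function.
-- Here this comes out by applying (y + 1)^{k+1} at 0 to x · fall k x = fall (k + 1) (x + 2).
res-X+1 : ∀ k → res (suc k) (X+1 ⋆ suc (suc k)) ≡ 0ℤ
res-X+1 k = begin
  res (suc k) (X+1 ⊗ X+1 ⋆ suc k)
    ≡⟨ res-cong (suc k) (P.trans (P.*-comm X+1 (X+1 ⋆ suc k)) (P.trans (P.*-congˡ X+1≈2X-[X-1])
         (P.trans (P.distribˡ (X+1 ⋆ suc k) _ _)
                  (P.+-cong (x∙yz≈y∙xz (X+1 ⋆ suc k) _ _) (x∙yz≈y∙xz (X+1 ⋆ suc k) _ _))))) ⟩
  + 2 * res (suc k) (X+1 ⋆ suc k ⊗ X) + -1ℤ * res (suc k) (X+1 ⋆ suc k ⊗ X-1)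
    ≡⟨ cong₂ (λ u v → + 2 * u + -1ℤ * v) via-leibniz via-X²-1 ⟩
  + 2 * (+ suc k * res k (X+1 ⋆ k)) + -1ℤ * (+ 2 * + suc k * res k (X+1 ⋆ k))
    ≡⟨ cancel (+ suc k) (res k (X+1 ⋆ k)) ⟩
  0ℤ ∎
  where
  open ≡-Reasoning
  -- Both pieces of y + 1 = 2y - (y - 1) contribute the same multiple of `res k (X+1 ⋆ k)`, and
  -- these cancel.
  X+1≈2X-[X-1] : X+1 ≈ con (+ 2) ⊗ X ⊕ con -1ℤ ⊗ X-1
  X+1≈2X-[X-1] = same λ f x → lem (f (x + 1ℤ)) (f x)
    where
    lem : ∀ u v → u + 1ℤ * v ≡ + 2 * u + -1ℤ * (u + -1ℤ * v)
    lem = solve-∀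
  cancel : ∀ m u → + 2 * (m * u) + -1ℤ * (+ 2 * m * u) ≡ 0ℤ
  cancel = solve-∀
  shift : ∀ y → act (X ⊗ X) (fall (suc k)) y ≡ (y + 0ℤ) * fall k y
  shift y = trans (cong (fall (suc k)) (ℤ.+-assoc y 1ℤ 1ℤ))
                  (trans (fall-head k y) (cong (_* fall k y) (sym (ℤ.+-identityʳ y))))
  via-leibniz : res (suc k) (X+1 ⋆ suc k ⊗ X) ≡ + suc k * res k (X+1 ⋆ k)
  via-leibniz = begin
    -- The extra X moves the evaluation point from 1 to 0, where the multiplier y + 0 vanishes and
    -- only the derivative term survives.
    act (X ⊗ (X+1 ⋆ suc k ⊗ X)) (fall (suc k)) 0ℤ
      ≡⟨ at (x∙yz≈y∙xz X (X+1 ⋆ suc k) X) (fall (suc k)) 0ℤ ⟩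
    act (X+1 ⋆ suc k ⊗ (X ⊗ X)) (fall (suc k)) 0ℤ
      ≡⟨ act-cong (X+1 ⋆ suc k) shift 0ℤ ⟩
    act (X+1 ⋆ suc k) (λ y → (y + 0ℤ) * fall k y) 0ℤ
      ≡⟨ leibniz (X+1 ⋆ suc k) 0ℤ (fall k) 0ℤ ⟩
    0ℤ + act (D (X+1 ⋆ suc k)) (fall k) 0ℤ
      ≡⟨ ℤ.+-identityˡ _ ⟩
    act (D (X+1 ⋆ suc k)) (fall k) 0ℤ
      ≡⟨ at (D-⋆ X+1 k) (fall k) 0ℤ ⟩
    + suc k * (res k (X+1 ⋆ k) + 0ℤ)
      ≡⟨ cong (+ suc k *_) (ℤ.+-identityʳ _) ⟩
    + suc k * res k (X+1 ⋆ k) ∎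
  via-X²-1 : res (suc k) (X+1 ⋆ suc k ⊗ X-1) ≡ + 2 * + suc k * res k (X+1 ⋆ k)
  via-X²-1 = trans (res-cong (suc k) (P.trans (P.*-comm (X+1 ⋆ suc k) X-1)
             (P.trans (P.sym (P.*-assoc X-1 X+1 (X+1 ⋆ k))) (P.*-comm (X-1 ⊗ X+1) (X+1 ⋆ k)))))
           (res-X²-1 k (X+1 ⋆ k))

-- With N = j + d + 1 the form is dy / (y - 1)^{d+2}, which has a primitive. Each step cancels a
-- pair (y - 1)(y + 1) against the denominator until j = 0.
res-X²-1-low : ∀ j d → res (suc (j ℕ.+ d)) (X-1 ⋆ j ⊗ X+1 ⋆ suc (suc (j ℕ.+ d))) ≡ 0ℤ
res-X²-1-low zero    d = trans (res-cong (suc d) (P.*-identityˡ (X+1 ⋆ suc (suc d)))) (res-X+1 d)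
res-X²-1-low (suc j) d = begin
  res (suc m) (X-1 ⋆ suc j ⊗ X+1 ⋆ suc (suc m))
    ≡⟨ res-cong (suc m) (P.trans (interchange X-1 (X-1 ⋆ j) X+1 (X+1 ⋆ suc m)) (P.*-comm (X-1 ⊗ X+1) _)) ⟩
  res (suc m) (X-1 ⋆ j ⊗ X+1 ⋆ suc m ⊗ (X-1 ⊗ X+1))
    ≡⟨ res-X²-1 m (X-1 ⋆ j ⊗ X+1 ⋆ suc m) ⟩
  + 2 * + suc m * res m (X-1 ⋆ j ⊗ X+1 ⋆ suc m)
    ≡⟨ cong (+ 2 * + suc m *_) (res-X²-1-low j d) ⟩
  + 2 * + suc m * 0ℤ
    ≡⟨ ℤ.*-zeroʳ (+ 2 * + suc m) ⟩
  0ℤ ∎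
  where
  open ≡-Reasoning
  m = suc (j ℕ.+ d)

-- Expanding by y + 3 = (y - 1) + 4 gives exponents of y - 1 at most j + r < N, so every pole has
-- order at least 2. The slack d grows when the term 4 is chosen.
res-low : ∀ r j d {N} → suc (r ℕ.+ (j ℕ.+ d)) ≡ N →
  res N (X-1 ⋆ j ⊗ (X+1 ⋆ suc N ⊗ X+3 ⋆ r)) ≡ 0ℤ
res-low zero    j d refl =
  trans (res-cong (suc (j ℕ.+ d)) (P.*-congˡ {X-1 ⋆ j} (P.*-identityʳ (X+1 ⋆ suc (suc (j ℕ.+ d)))))) (res-X²-1-low j d)
res-low (suc r) j d {N} eq = begin
  res N (X-1 ⋆ j ⊗ (X+1 ⋆ suc N ⊗ (X+3 ⊗ X+3 ⋆ r)))
    ≡⟨ res-cong N expand ⟩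
  res N (X-1 ⋆ suc j ⊗ Q) + + 4 * res N (X-1 ⋆ j ⊗ Q)
    ≡⟨ cong₂ (λ u v → u + + 4 * v) (res-low r (suc j) d (trans (cong suc (ℕ.+-suc r _)) eq))
             (res-low r j (suc d) (trans (cong suc (trans (cong (r ℕ.+_) (ℕ.+-suc j d)) (ℕ.+-suc r _))) eq)) ⟩
  0ℤ ∎
  where
  open ≡-Reasoning
  Q = X+1 ⋆ suc N ⊗ X+3 ⋆ r
  X+3≈[X-1]+4 : X+3 ≈ X-1 ⊕ con (+ 4)
  X+3≈[X-1]+4 = same λ f x → lem (f (x + 1ℤ)) (f x)
    where
    lem : ∀ u v → u + + 3 * v ≡ u + -1ℤ * v + + 4 * v
    lem = solve-∀
  expand : X-1 ⋆ j ⊗ (X+1 ⋆ suc N ⊗ (X+3 ⊗ X+3 ⋆ r)) ≈ X-1 ⋆ suc j ⊗ Q ⊕ con (+ 4) ⊗ (X-1 ⋆ j ⊗ Q)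
  expand = P.trans (P.*-congˡ {X-1 ⋆ j} (x∙yz≈y∙xz (X+1 ⋆ suc N) X+3 _))
    (P.trans (x∙yz≈y∙xz (X-1 ⋆ j) X+3 Q)
    (P.trans (P.*-congʳ {X-1 ⋆ j ⊗ Q} X+3≈[X-1]+4)
    (P.trans (P.distribʳ (X-1 ⋆ j ⊗ Q) X-1 (con (+ 4)))
    (P.+-congʳ (P.sym (P.*-assoc X-1 (X-1 ⋆ j) Q))))))

res-X-1²-high : ∀ n s → n ℕ.≤ s → ∀ P → res (suc (2 ℕ.* n)) ((X-1 ⋆ 2) ⋆ suc s ⊗ P) ≡ 0ℤ
res-X-1²-high n s n≤s P = trans (res-cong N split) (res-X-1-high N (X-1 ⋆ (2 ℕ.* d) ⊗ P))
  where
  N = suc (2 ℕ.* n)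
  d = s ℕ.∸ n
  exponent : 2 ℕ.* suc s ≡ suc N ℕ.+ 2 ℕ.* d
  exponent = trans (cong (λ t → 2 ℕ.* suc t) (sym (ℕ.m+[n∸m]≡n n≤s)))
    (trans (ℕ.*-distribˡ-+ 2 (suc n) d) (cong (ℕ._+ 2 ℕ.* d) (ℕ.*-suc 2 n)))
  split : (X-1 ⋆ 2) ⋆ suc s ⊗ P ≈ X-1 ⋆ suc N ⊗ (X-1 ⋆ (2 ℕ.* d) ⊗ P)
  split = P.trans (P.*-congʳ {P} (P.trans (^-assocʳ X-1 2 (suc s))
      (P.trans (^-congʳ X-1 exponent) (^-homo-* X-1 (suc N) (2 ℕ.* d)))))
    (P.*-assoc (X-1 ⋆ suc N) _ P)

-- In the coordinate z the form is a constant times dz / (z^{2r+2} (1 − z²)^p), and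
-- 1 = (1 − z²) + z² lowers p or r; homogenised, this is (y + 3)² = 8(y + 1) + (y − 1)².
res-even : ∀ n r p s l → r ℕ.+ s ≡ n → p ℕ.+ l ≡ suc (suc (2 ℕ.* n)) →
  res (suc (2 ℕ.* n)) ((X-1 ⋆ 2) ⋆ s ⊗ (X+1 ⋆ l ⊗ (X+3 ⋆ 2) ⋆ (p ℕ.+ r))) ≡ 0ℤ
res-even n r zero s _ refl refl = begin
  res N ((X-1 ⋆ 2) ⋆ s ⊗ (X+1 ⋆ suc N ⊗ (X+3 ⋆ 2) ⋆ r))
    ≡⟨ res-cong N (P.*-cong (^-assocʳ X-1 2 s) (P.*-congˡ {X+1 ⋆ suc N} (^-assocʳ X+3 2 r))) ⟩
  res N (X-1 ⋆ (2 ℕ.* s) ⊗ (X+1 ⋆ suc N ⊗ X+3 ⋆ (2 ℕ.* r)))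
    -- The slack is 0: the highest exponent of y - 1 is 2r + 2s = N - 1, which still leaves a double
    -- pole.
    ≡⟨ res-low (2 ℕ.* r) (2 ℕ.* s) 0 (cong suc (trans (cong (2 ℕ.* r ℕ.+_) (ℕ.+-identityʳ _))
                                               (sym (ℕ.*-distribˡ-+ 2 r s)))) ⟩
  0ℤ ∎
  where
  open ≡-Reasoning
  N = suc (2 ℕ.* n)
res-even n r (suc p) s l r+s≡n p+l≡ = begin
  res N ((X-1 ⋆ 2) ⋆ s ⊗ (X+1 ⋆ l ⊗ (X+3 ⋆ 2 ⊗ Q)))
    ≡⟨ res-cong N expand ⟩
  + 8 * res N ((X-1 ⋆ 2) ⋆ s ⊗ (X+1 ⋆ suc l ⊗ Q)) + res N ((X-1 ⋆ 2) ⋆ suc s ⊗ (X+1 ⋆ l ⊗ Q))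
    ≡⟨ cong₂ (λ u v → + 8 * u + v)
         (res-even n r p s (suc l) r+s≡n (trans (ℕ.+-suc p l) p+l≡)) (raise r r+s≡n) ⟩
  0ℤ ∎
  where
  open ≡-Reasoning
  N = suc (2 ℕ.* n)
  Q = (X+3 ⋆ 2) ⋆ (p ℕ.+ r)
  [X+3]²≈8[X+1]+[X-1]² : X+3 ⋆ 2 ≈ con (+ 8) ⊗ X+1 ⊕ X-1 ⋆ 2
  [X+3]²≈8[X+1]+[X-1]² = same λ f x → lem (f (x + 1ℤ + 1ℤ)) (f (x + 1ℤ)) (f x)
    where
    lem : ∀ u v w → 1ℤ * u + + 3 * (1ℤ * v) + + 3 * (1ℤ * v + + 3 * (1ℤ * w))
      ≡ + 8 * (v + 1ℤ * w) + (1ℤ * u + -1ℤ * (1ℤ * v) + -1ℤ * (1ℤ * v + -1ℤ * (1ℤ * w)))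
    lem = solve-∀
  expand : (X-1 ⋆ 2) ⋆ s ⊗ (X+1 ⋆ l ⊗ (X+3 ⋆ 2 ⊗ Q))
    ≈ con (+ 8) ⊗ ((X-1 ⋆ 2) ⋆ s ⊗ (X+1 ⋆ suc l ⊗ Q)) ⊕ (X-1 ⋆ 2) ⋆ suc s ⊗ (X+1 ⋆ l ⊗ Q)
  expand = P.trans (P.*-congˡ {(X-1 ⋆ 2) ⋆ s} (x∙yz≈y∙xz (X+1 ⋆ l) (X+3 ⋆ 2) Q))
    (P.trans (x∙yz≈y∙xz ((X-1 ⋆ 2) ⋆ s) (X+3 ⋆ 2) _)
    (P.trans (P.*-congʳ {(X-1 ⋆ 2) ⋆ s ⊗ (X+1 ⋆ l ⊗ Q)} [X+3]²≈8[X+1]+[X-1]²)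
    (P.trans (P.distribʳ ((X-1 ⋆ 2) ⋆ s ⊗ (X+1 ⋆ l ⊗ Q)) (con (+ 8) ⊗ X+1) (X-1 ⋆ 2))
    (P.+-cong (P.trans (P.*-assoc (con (+ 8)) X+1 _) (P.*-congˡ {con (+ 8)}
                (P.trans (x∙yz≈y∙xz X+1 ((X-1 ⋆ 2) ⋆ s) _)
                         (P.*-congˡ {(X-1 ⋆ 2) ⋆ s} (P.sym (P.*-assoc X+1 (X+1 ⋆ l) Q))))))
              (P.sym (P.*-assoc (X-1 ⋆ 2) ((X-1 ⋆ 2) ⋆ s) _))))))
  -- Another (y - 1)² is paid for by lowering r. At r = 0, s = n and the exponent 2n + 2 = N + 1
  -- removes the pole.
  raise : ∀ r → r ℕ.+ s ≡ n → res N ((X-1 ⋆ 2) ⋆ suc s ⊗ (X+1 ⋆ l ⊗ (X+3 ⋆ 2) ⋆ (p ℕ.+ r))) ≡ 0ℤ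
  raise zero    refl = res-X-1²-high s s ℕ.≤-refl (X+1 ⋆ l ⊗ (X+3 ⋆ 2) ⋆ (p ℕ.+ zero))
  raise (suc r) eq   =
    trans (cong (λ t → res N ((X-1 ⋆ 2) ⋆ suc s ⊗ (X+1 ⋆ l ⊗ (X+3 ⋆ 2) ⋆ t))) (ℕ.+-suc p r))
          (res-even n r (suc p) (suc s) l (trans (ℕ.+-suc r s) eq) p+l≡)

-- Expansion in even powers of y - 1 and y + 3.

Diff : Poly
Diff = con (+ 9) ⊗ X-1 ⋆ 2 ⊕ con -1ℤ ⊗ X+3 ⋆ 2

-- Expanding one `Diff` at a time preserves j + s + t = 3n + 2. At j = 0 either s > n and no pole is
-- left, or t = (N + 1) + (n - s), which is `res-even` with p = N + 1 and l = 0.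
res-Diff : ∀ n j s t → j ℕ.+ (s ℕ.+ t) ≡ suc (suc (2 ℕ.* n)) ℕ.+ n →
  res (suc (2 ℕ.* n)) (Diff ⋆ j ⊗ ((X-1 ⋆ 2) ⋆ s ⊗ (X+3 ⋆ 2) ⋆ t)) ≡ 0ℤ
res-Diff n zero s t eq = trans (res-cong N (P.*-identityˡ ((X-1 ⋆ 2) ⋆ s ⊗ (X+3 ⋆ 2) ⋆ t))) (go s eq)
  where
  N = suc (2 ℕ.* n)
  go : ∀ s → s ℕ.+ t ≡ suc N ℕ.+ n → res N ((X-1 ⋆ 2) ⋆ s ⊗ (X+3 ⋆ 2) ⋆ t) ≡ 0ℤ
  go s eq with s ℕ.≤? n
  ... | yes s≤n =
    trans (res-cong N (P.*-congˡ {(X-1 ⋆ 2) ⋆ s}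
            (P.trans (^-congʳ (X+3 ⋆ 2) t≡) (P.sym (P.*-identityˡ _)))))
          (res-even n (n ℕ.∸ s) (suc N) s 0 (ℕ.m∸n+n≡m s≤n) (ℕ.+-identityʳ (suc N)))
    where
    t≡ : t ≡ suc N ℕ.+ (n ℕ.∸ s)
    t≡ = trans (sym (ℕ.m+n∸m≡n s t)) (trans (cong (ℕ._∸ s) eq) (ℕ.+-∸-assoc (suc N) s≤n))
  ... | no s≰n with s | ℕ.≰⇒> s≰n
  ...   | suc s′ | ℕ.s≤s n≤s′ = res-X-1²-high n s′ n≤s′ ((X+3 ⋆ 2) ⋆ t)
res-Diff n (suc j) s t eq = begin
  res N (Diff ⊗ Diff ⋆ j ⊗ (U ⋆ s ⊗ V ⋆ t))
    ≡⟨ res-cong N expand ⟩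
  + 9 * res N (Diff ⋆ j ⊗ (U ⋆ suc s ⊗ V ⋆ t)) + -1ℤ * res N (Diff ⋆ j ⊗ (U ⋆ s ⊗ V ⋆ suc t))
    ≡⟨ cong₂ (λ u v → + 9 * u + -1ℤ * v)
         (res-Diff n j (suc s) t (trans (ℕ.+-suc j _) eq))
         (res-Diff n j s (suc t) (trans (cong (j ℕ.+_) (ℕ.+-suc s t)) (trans (ℕ.+-suc j _) eq))) ⟩
  0ℤ ∎
  where
  open ≡-Reasoning
  N = suc (2 ℕ.* n)
  U = X-1 ⋆ 2
  V = X+3 ⋆ 2
  move : ∀ c W {R} → W ⊗ (U ⋆ s ⊗ V ⋆ t) ≈ R →
    con c ⊗ W ⊗ (Diff ⋆ j ⊗ (U ⋆ s ⊗ V ⋆ t)) ≈ con c ⊗ (Diff ⋆ j ⊗ R)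
  move c W e = P.trans (P.*-assoc (con c) W _)
    (P.*-congˡ {con c} (P.trans (x∙yz≈y∙xz W (Diff ⋆ j) _) (P.*-congˡ {Diff ⋆ j} e)))
  expand : Diff ⊗ Diff ⋆ j ⊗ (U ⋆ s ⊗ V ⋆ t)
    ≈ con (+ 9) ⊗ (Diff ⋆ j ⊗ (U ⋆ suc s ⊗ V ⋆ t)) ⊕ con -1ℤ ⊗ (Diff ⋆ j ⊗ (U ⋆ s ⊗ V ⋆ suc t))
  expand = P.trans (P.*-assoc Diff (Diff ⋆ j) _)
    (P.trans (P.distribʳ (Diff ⋆ j ⊗ (U ⋆ s ⊗ V ⋆ t)) (con (+ 9) ⊗ U) (con -1ℤ ⊗ V))
    (P.+-cong (move (+ 9) U (P.sym (P.*-assoc U (U ⋆ s) (V ⋆ t))))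
              (move -1ℤ V (x∙yz≈y∙xz V (U ⋆ s) (V ⋆ t)))))

-- The polynomial behind the two sums.

con-⋆ : ∀ c k → con c ⋆ k ≈ con (c ^ k)
con-⋆ c zero    = P.refl
con-⋆ c (suc k) = P.trans (P.*-congˡ {con c} (con-⋆ c k))
                          (same λ f x → sym (ℤ.*-assoc c (c ^ k) (f x)))

-- With -9 as first summand, the binomial theorem gives it the exponent k, whence (-1)^k 3^{2k}. In
-- y + 3, the term 3 yields the first sum and y the second.
Kernel : ℕ → Poly
Kernel N = X ⋆ N ⊗ ((con (- + 9) ⊕ X ⋆ 2) ⋆ N ⊗ X+3)

-- Splitting y² - 9 pairs each y with a y - 3, and 8y(y - 3) is `Diff`; the factors y + 3 total N +
-- 1.
8^N*Kernel : ∀ N → con (+ 8) ⋆ N ⊗ Kernel N ≈ Diff ⋆ N ⊗ X+3 ⋆ suc N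
8^N*Kernel N = begin
  con (+ 8) ⋆ N ⊗ (X ⋆ N ⊗ ((con (- + 9) ⊕ X ⋆ 2) ⋆ N ⊗ X+3))
    ≈⟨ P.*-congˡ {con (+ 8) ⋆ N} (P.*-congˡ {X ⋆ N} factor) ⟩
  con (+ 8) ⋆ N ⊗ (X ⋆ N ⊗ (X-3 ⋆ N ⊗ X+3 ⋆ suc N))
    ≈⟨ P.*-congˡ {con (+ 8) ⋆ N} (merge X X-3) ⟩
  con (+ 8) ⋆ N ⊗ ((X ⊗ X-3) ⋆ N ⊗ X+3 ⋆ suc N)
    ≈⟨ merge (con (+ 8)) (X ⊗ X-3) ⟩
  (con (+ 8) ⊗ (X ⊗ X-3)) ⋆ N ⊗ X+3 ⋆ suc N
    ≈⟨ P.*-congʳ {X+3 ⋆ suc N} (^-congˡ N 8X[X-3]≈Diff) ⟩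
  Diff ⋆ N ⊗ X+3 ⋆ suc N ∎
  where
  open ≈-Reasoning
  X-3 = X ⊕ con (- + 3)
  merge : ∀ P Q {R} → P ⋆ N ⊗ (Q ⋆ N ⊗ R) ≈ (P ⊗ Q) ⋆ N ⊗ R
  merge P Q {R} = P.trans (P.sym (P.*-assoc (P ⋆ N) (Q ⋆ N) R))
                          (P.*-congʳ {R} (P.sym (^-distrib-* P Q N)))
  X²-9≈ : con (- + 9) ⊕ X ⋆ 2 ≈ X-3 ⊗ X+3
  X²-9≈ = same λ f x → lem (f (x + 1ℤ + 1ℤ)) (f (x + 1ℤ)) (f x)
    where
    lem : ∀ u v w → (- + 9) * w + 1ℤ * u ≡ u + + 3 * v + (- + 3) * (v + + 3 * w)
    lem = solve-∀
  8X[X-3]≈Diff : con (+ 8) ⊗ (X ⊗ X-3) ≈ Diff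
  8X[X-3]≈Diff = same λ f x → lem (f (x + 1ℤ + 1ℤ)) (f (x + 1ℤ)) (f x)
    where
    lem : ∀ u v w → + 8 * (u + (- + 3) * v)
      ≡ + 9 * (1ℤ * u + -1ℤ * (1ℤ * v) + -1ℤ * (1ℤ * v + -1ℤ * (1ℤ * w)))
        + -1ℤ * (1ℤ * u + + 3 * (1ℤ * v) + + 3 * (1ℤ * v + + 3 * (1ℤ * w)))
    lem = solve-∀
  factor : (con (- + 9) ⊕ X ⋆ 2) ⋆ N ⊗ X+3 ≈ X-3 ⋆ N ⊗ X+3 ⋆ suc N
  factor = P.trans (P.*-congʳ {X+3} (P.trans (^-congˡ N X²-9≈) (^-distrib-* X-3 X+3 N)))
    (P.trans (P.*-assoc (X-3 ⋆ N) (X+3 ⋆ N) X+3)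
             (P.*-congˡ {X-3 ⋆ N} (P.*-comm (X+3 ⋆ N) X+3)))

res-Kernel : ∀ n → res (suc (2 ℕ.* n)) (Kernel (suc (2 ℕ.* n))) ≡ 0ℤ
res-Kernel n = [ (λ 8^N≡0 → contradiction (ℤ.i^n≡0⇒i≡0 (+ 8) N 8^N≡0) λ ()) , id ]′
                 (ℤ.i*j≡0⇒i≡0∨j≡0 ((+ 8) ^ N) scaled)
  where
  N = suc (2 ℕ.* n)
  open ≡-Reasoning
  scaled : (+ 8) ^ N * res N (Kernel N) ≡ 0ℤ
  scaled = begin
    res N (con ((+ 8) ^ N) ⊗ Kernel N)
      ≡⟨ res-cong N (P.*-congʳ {Kernel N} (con-⋆ (+ 8) N)) ⟨
    res N (con (+ 8) ⋆ N ⊗ Kernel N)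
      ≡⟨ res-cong N (8^N*Kernel N) ⟩
    res N (Diff ⋆ N ⊗ X+3 ⋆ suc N)
      -- Here N odd is used: N + 1 = 2(n + 1), so (y + 3)^{N+1} is a power of (y + 3)².
      ≡⟨ res-cong N (P.*-congˡ {Diff ⋆ N} (P.trans (P.sym (P.trans (^-assocʳ X+3 2 (suc n))
           (^-congʳ X+3 (ℕ.*-suc 2 n)))) (P.sym (P.*-identityˡ _)))) ⟩
    res N (Diff ⋆ N ⊗ ((X-1 ⋆ 2) ⋆ 0 ⊗ (X+3 ⋆ 2) ⋆ suc n))
      ≡⟨ res-Diff n N 0 (suc n) (ℕ.+-suc N n) ⟩
    0ℤ ∎

-- From the kernel back to the sums.

act-sum : ∀ {m} (v : Fin m → Poly) f x → act (PolySum.sum v) f x ≡ sum (λ i → act (v i) f x)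
act-sum {zero}  v f x = refl
act-sum {suc m} v f x = cong (λ z → act (v Fin.zero) f x + z) (act-sum (v ∘ Fin.suc) f x)

act-× : ∀ n P f x → act (n PolyMult.× P) f x ≡ + n * act P f x
act-× zero    P f x = refl
act-× (suc n) P f x = trans (cong (λ z → act P f x + z) (act-× n P f x)) (sym (ℤ.suc-* (+ n) _))

act-X⋆ : ∀ m f x → act (X ⋆ m) f x ≡ f (x + + m)
act-X⋆ zero    f x = trans (ℤ.*-identityˡ (f x)) (cong f (sym (ℤ.+-identityʳ x)))
act-X⋆ (suc m) f x = trans (act-X⋆ m f (x + 1ℤ)) (cong f (ℤ.+-assoc x 1ℤ (+ m)))

act-binomial : ∀ N c g x → act ((con c ⊕ X ⋆ 2) ⋆ N) g x
  ≡ ∑[0≤ k ≤ N ] (+ (N C k) * (c ^ k * g (x + + (2 ℕ.* (N ℕ.∸ k)))))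
act-binomial N c g x = begin
  act ((con c ⊕ X ⋆ 2) ⋆ N) g x
    ≡⟨ at (Binomial.theorem N (con c) (X ⋆ 2)) g x ⟩
  act (Binomial.binomialExpansion (con c) (X ⋆ 2) N) g x
    ≡⟨ act-sum (Binomial.binomialTerm (con c) (X ⋆ 2) N) g x ⟩
  sum (λ i → act (Binomial.binomialTerm (con c) (X ⋆ 2) N i) g x)
    ≡⟨ sum-cong-≗ {suc N} (λ i → term (toℕ i)) ⟩
  _ ∎
  where
  open ≡-Reasoning
  term : ∀ k → act ((N C k) PolyMult.× (con c ⋆ k ⊗ (X ⋆ 2) ⋆ (N ℕ.∸ k))) g x
    ≡ + (N C k) * (c ^ k * g (x + + (2 ℕ.* (N ℕ.∸ k))))
  term k = trans (act-× (N C k) _ g x) (cong (+ (N C k) *_)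
    (trans (at (P.*-cong (con-⋆ c k) (^-assocʳ X 2 (N ℕ.∸ k))) g x)
           (cong (c ^ k *_) (act-X⋆ (2 ℕ.* (N ℕ.∸ k)) g x))))

-9^k : ∀ k → (- + 9) ^ k ≡ -1ℤ ^ k * (+ 3) ^ (2 ℕ.* k)
-9^k k = trans (go k) (cong (-1ℤ ^ k *_) (ℤ.^-*-assoc (+ 3) 2 k))
  where
  lem : ∀ a b → (- + 9) * (a * b) ≡ -1ℤ * a * (+ 9 * b)
  lem = solve-∀
  go : ∀ k → (- + 9) ^ k ≡ -1ℤ ^ k * (+ 9) ^ k
  go zero    = refl
  go (suc k) = trans (cong ((- + 9) *_) (go k)) (lem (-1ℤ ^ k) ((+ 9) ^ k))

theorem1p2 : (n : ℕ) →
    let N = 2 ℕ.* n ℕ.+ 1 in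
    (∑[0≤ k ≤ N ] (+ (N C k) * (∏[1≤ j ≤ N ] (+ 6 * + n - + 2 * + k + + 4 - + 2 * + j)) * -1ℤ ^ k * (+ 3) ^ (2 ℕ.* k ℕ.+ 1)))
    + (∑[0≤ k ≤ N ] (+ (N C k) * (∏[1≤ j ≤ N ] (+ 6 * + n - + 2 * + k + + 5 - + 2 * + j)) * -1ℤ ^ k * (+ 3) ^ (2 ℕ.* k)))
    ≡ 0ℤ
theorem1p2 n rewrite ℕ.+-comm (2 ℕ.* n) 1 = begin
  sum (λ (i : Fin (suc N)) → a (toℕ i)) + sum (λ (i : Fin (suc N)) → b (toℕ i))
    ≡⟨ ∑-distrib-+ {suc N} (a ∘ toℕ) (b ∘ toℕ) ⟨
  sum (λ (i : Fin (suc N)) → a (toℕ i) + b (toℕ i))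
    ≡⟨ sum-cong-≗ {suc N} (λ i → term (toℕ i) (toℕ≤pred[n] i)) ⟩
  ∑[0≤ k ≤ N ] (+ (N C k) * ((- + 9) ^ k * g (1ℤ + + N + + (2 ℕ.* (N ℕ.∸ k)))))
    ≡⟨ act-binomial N (- + 9) g (1ℤ + + N) ⟨
  act ((con (- + 9) ⊕ X ⋆ 2) ⋆ N) g (1ℤ + + N)
    -- The factor y^N shifts the evaluation point from 1 to 1 + N.
    ≡⟨ act-X⋆ N (act ((con (- + 9) ⊕ X ⋆ 2) ⋆ N) g) 1ℤ ⟨
  res N (Kernel N)
    ≡⟨ res-Kernel n ⟩
  0ℤ ∎
  where
  open ≡-Reasoning
  N = suc (2 ℕ.* n)
  g = act X+3 (fall N)
  c : ℕ → ℤ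
  c k = + 6 * + n - + 2 * + k
  a b : ℕ → ℤ
  a k = + (N C k) * fall N (c k + + 4) * -1ℤ ^ k * (+ 3) ^ (2 ℕ.* k ℕ.+ 1)
  b k = + (N C k) * fall N (c k + + 5) * -1ℤ ^ k * (+ 3) ^ (2 ℕ.* k)
  argument : ∀ k → k ℕ.≤ N → 1ℤ + + N + + (2 ℕ.* (N ℕ.∸ k)) ≡ c k + + 4
  argument k k≤N = begin
    1ℤ + + N + + (2 ℕ.* (N ℕ.∸ k))
      -- As k ≤ N, the truncated difference is the integer N - k.
      ≡⟨ cong (λ z → 1ℤ + + N + z) (trans (ℤ.pos-* 2 (N ℕ.∸ k))
           (cong (+ 2 *_) (trans (sym (ℤ.⊖-≥ k≤N)) (sym (ℤ.m-n≡m⊖n N k))))) ⟩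
    1ℤ + + N + + 2 * (+ N - + k)
      ≡⟨ cong (λ z → 1ℤ + (1ℤ + z) + + 2 * (1ℤ + z - + k)) (ℤ.pos-* 2 n) ⟩
    1ℤ + (1ℤ + + 2 * + n) + + 2 * (1ℤ + + 2 * + n - + k)
      ≡⟨ lem (+ n) (+ k) ⟩
    c k + + 4 ∎
    where
    lem : ∀ n k → 1ℤ + (1ℤ + + 2 * n) + + 2 * (1ℤ + + 2 * n - k) ≡ + 6 * n - + 2 * k + + 4
    lem = solve-∀
  term : ∀ k → k ℕ.≤ N →
    a k + b k ≡ + (N C k) * ((- + 9) ^ k * g (1ℤ + + N + + (2 ℕ.* (N ℕ.∸ k))))
  term k k≤N = begin
    a k + b k
      ≡⟨ cong (λ z → + (N C k) * fall N (c k + + 4) * -1ℤ ^ k * z + b k)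
           (ℤ.^-distribˡ-+-* (+ 3) (2 ℕ.* k) 1) ⟩
    + (N C k) * fall N (c k + + 4) * -1ℤ ^ k * ((+ 3) ^ (2 ℕ.* k) * (+ 3) ^ 1) + b k
      ≡⟨ lem (+ (N C k)) (fall N (c k + + 4)) (fall N (c k + + 5)) (-1ℤ ^ k) ((+ 3) ^ (2 ℕ.* k)) ⟩
    + (N C k) * (-1ℤ ^ k * (+ 3) ^ (2 ℕ.* k) * (fall N (c k + + 5) + + 3 * fall N (c k + + 4)))
      ≡⟨ cong₂ (λ u v → + (N C k) * (u * (fall N v + + 3 * fall N (c k + + 4))))
           (sym (-9^k k)) (sym (ℤ.+-assoc (c k) (+ 4) 1ℤ)) ⟩
    + (N C k) * ((- + 9) ^ k * g (c k + + 4))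
      ≡⟨ cong (λ z → + (N C k) * ((- + 9) ^ k * g z)) (argument k k≤N) ⟨
    + (N C k) * ((- + 9) ^ k * g (1ℤ + + N + + (2 ℕ.* (N ℕ.∸ k)))) ∎
    where
    lem : ∀ m u v s t → m * u * s * (t * + 3) + m * v * s * t ≡ m * (s * t * (v + + 3 * u))
    lem = solve-∀
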